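{- For every integer $p\geq 0$, \[ \sum_{n=1}^\infty\frac{\binom{2n}{n}}{4^n n^{p+1}}=-2\,\zeta(\bar{1},\{\hat{1}\}_p)\,, \] where $\zeta(\bar 1,\{\hat 1\}_p)=\sum_{n_1>n_2>\cdots>n_{p+1}\geq 1}\frac{(-1)^{n_1}}{n_1}\prod_{j=2}^{p+1}\frac{1+(-1)^{n_j}}{n_j}$.
   Context: Notation for mixed multiple zeta values: for positive integers $s_1,\dots,s_m$, each possibly decorated by a bar, a hat or a tilde, $\zeta(s_1,\dots,s_m)$ denotes $\sum_{n_1>n_2>\cdots>n_m\geq 1}\prod_{j=1}^m \frac{\epsilon_j(n_j)}{n_j^{s_j}}$, where $\epsilon_j(n)=1$ if $s_j$ is undecorated, $(-1)^n$ if $s_j$ carries a bar ($\bar s_j$), $1+(-1)^n$ if it carries a hat ($\hat s_j$), and $1-(-1)^n$ if it carries a tilde ($\tilde s_j$); these are only used when the series converges. $\{a\}_p$ denotes $p$ repetitions of $a$, and $\{a\}_0$ is empty. For $p=0$, the right-hand side is $-2\zeta(\bar 1)=2\ln 2$. -}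

module Defs where

open import Data.Nat as ℕ using (ℕ; zero; suc)
open import Data.Nat.Combinatorics using (_C_)
open import Data.Integer as ℤ using (ℤ; +_)
open import Data.Rational using (ℚ; _+_; _*_; -_; _/_; 0ℚ; 1ℚ)

negOnePow : ℕ → ℚ
negOnePow zero    = 1ℚ
negOnePow (suc n) = - negOnePow n

sumFrom1 : ℕ → (ℕ → ℚ) → ℚ
sumFrom1 zero    f = 0ℚ
sumFrom1 (suc N) f = sumFrom1 N f + f (suc N)

inv : (k : ℕ) → ℚ
inv k = + 1 / suc k

powQ : ℚ → ℕ → ℚ
powQ x zero    = 1ℚ
powQ x (suc n) = x * powQ x n

lhsTerm : ℕ → ℕ → ℚ
lhsTerm p k = (+ ((2 ℕ.* suc k) C suc k) / 1) * (powQ (+ 1 / 4) (suc k) * powQ (inv k) (suc p))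

lhsPartial : ℕ → ℕ → ℚ
lhsPartial p N = sumFrom1 N (λ { zero → 0ℚ ; (suc k) → lhsTerm p k })

-- hatTail p m = Σ_{m > n_1 > ... > n_p ≥ 1} Π_j (1 + (-1)^{n_j}) / n_j
hatTail : ℕ → ℕ → ℚ
hatTail zero    m       = 1ℚ
hatTail (suc p) zero    = 0ℚ
hatTail (suc p) (suc m) =
  sumFrom1 m (λ { zero → 0ℚ
                ; (suc k) → ((1ℚ + negOnePow (suc k)) * inv k) * hatTail p (suc k) })

zetaBar1Hat1Partial : ℕ → ℕ → ℚ
zetaBar1Hat1Partial p N =
  sumFrom1 N (λ { zero → 0ℚ
                ; (suc k) → (negOnePow (suc k) * inv k) * hatTail p (suc k) })

{-# OPTIONS --safe #-}
module Submission where

open import Defs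
open import Data.Nat as ℕ using (ℕ; zero; suc; _≤_)
import Data.Nat.Properties as ℕ
import Data.Nat.Solver as ℕS
open import Data.Nat.Base using (_!)
open import Data.Nat.Combinatorics using (_C_; nCk≡n!/k![n-k]!; k![n∸k]!∣n!)
open import Data.Nat.DivMod using (m/n*n≡m)
open import Data.Integer as ℤ using (+_)
import Data.Integer.Properties as ℤ
open import Data.Rational renaming (_≤_ to _≤ℚ_)
open import Data.Rational.Properties
open import Data.Rational.Solver
import Data.Rational.Unnormalised as ℚᵘ
import Data.Rational.Unnormalised.Properties as ℚᵘ
open import Data.Product using (_×_; _,_; ∃-syntax; map₂; proj₁; proj₂)
open import Data.Sum using (_⊎_; inj₁; inj₂; [_,_]′)
open import Relation.Binary.PropositionalEquality
open +-*-Solver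

-- Put a(n) = C(2n,n)/4^n and c(n,m) = n! m!/(n+m)!.  From
--   c(n,m)/n - c(n,m+1)/n = c(n,m)/(n+m+1) = c(n,m+1)/(m+1)
-- the truncations L_q(m) = Σ_{n ≤ N} a(n) c(n,m)/n^{q+1} satisfy
--   L_{q+1}(m) - L_{q+1}(m+1) = L_q(m+1)/(m+1),
-- while L_0(m) - L_0(m+1) telescopes in n to
-- 2/(2m+1) - 2/(2m+2) minus a boundary term at N+1.  Since hatTail p at 2m+1
-- and at 2m+2 is the elementary symmetric polynomial e_p(1, …, 1/m),
-- p summations by parts turn L_p(0), the left-hand partial sum up to N, into
-- minus twice the zeta partial sum up to 2M, plus error terms.  These are
-- O(a(M+1)) when M ≤ N, because e_p(1, …, 1/m)/(m+1) ≤ 2^{p+1} a(m+1), and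
-- a(n)² ≤ 1/(n+1).

-- Natural numbers and their reciprocals in `ℚ`.

ι : ℕ → ℚ
ι n = + n / 1

2ℚ : ℚ
2ℚ = + 2 / 1

-- Normalised fractions with variable entries do not reduce. Identities between them are therefore
-- checked by cross-multiplication on unnormalised rationals and carried over by `fromℚᵘ`.
fromℚᵘ-homo-+ : ∀ p q → fromℚᵘ (p ℚᵘ.+ q) ≡ fromℚᵘ p + fromℚᵘ q
fromℚᵘ-homo-+ p q = toℚᵘ-injective (ℚᵘ.≃-trans (toℚᵘ-fromℚᵘ (p ℚᵘ.+ q)) (ℚᵘ.≃-sym
  (ℚᵘ.≃-trans (toℚᵘ-homo-+ (fromℚᵘ p) (fromℚᵘ q)) (ℚᵘ.+-cong (toℚᵘ-fromℚᵘ p) (toℚᵘ-fromℚᵘ q)))))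

fromℚᵘ-homo-* : ∀ p q → fromℚᵘ (p ℚᵘ.* q) ≡ fromℚᵘ p * fromℚᵘ q
fromℚᵘ-homo-* p q = toℚᵘ-injective (ℚᵘ.≃-trans (toℚᵘ-fromℚᵘ (p ℚᵘ.* q)) (ℚᵘ.≃-sym
  (ℚᵘ.≃-trans (toℚᵘ-homo-* (fromℚᵘ p) (fromℚᵘ q)) (ℚᵘ.*-cong (toℚᵘ-fromℚᵘ p) (toℚᵘ-fromℚᵘ q)))))

ιᵘ invᵘ : ℕ → ℚᵘ.ℚᵘ
ιᵘ n = ℚᵘ.mkℚᵘ (+ n) 0
invᵘ k = ℚᵘ.mkℚᵘ (+ 1) k

ι-+ : ∀ m n → ι (m ℕ.+ n) ≡ ι m + ι n
ι-+ m n = trans (fromℚᵘ-cong {ιᵘ (m ℕ.+ n)} {ιᵘ m ℚᵘ.+ ιᵘ n} (ℚᵘ.*≡* (cong (ℤ._* + 1)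
  (sym (cong₂ ℤ._+_ (ℤ.*-identityʳ (+ m)) (ℤ.*-identityʳ (+ n))))))) (fromℚᵘ-homo-+ (ιᵘ m) (ιᵘ n))

ι-* : ∀ m n → ι (m ℕ.* n) ≡ ι m * ι n
ι-* m n = trans (fromℚᵘ-cong {ιᵘ (m ℕ.* n)} {ιᵘ m ℚᵘ.* ιᵘ n} (ℚᵘ.*≡* (cong (ℤ._* + 1) (ℤ.pos-* m n))))
  (fromℚᵘ-homo-* (ιᵘ m) (ιᵘ n))

inv-inverse : ∀ k → inv k * ι (suc k) ≡ 1ℚ
inv-inverse k = trans (sym (fromℚᵘ-homo-* (invᵘ k) (ιᵘ (suc k))))
  (fromℚᵘ-cong {invᵘ k ℚᵘ.* ιᵘ (suc k)} {ιᵘ 1} (ℚᵘ.*≡* (trans (ℤ.*-identityʳ (+ 1 ℤ.* + suc k))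
    (cong (λ d → + 1 ℤ.* + d) (sym (ℕ.*-identityʳ (suc k)))))))

ι-suc : ∀ n → ι (suc n) ≡ 1ℚ + ι n
ι-suc = ι-+ 1

inv-inverse′ : ∀ k → inv k * (1ℚ + ι k) ≡ 1ℚ
inv-inverse′ k = trans (cong (inv k *_) (sym (ι-suc k))) (inv-inverse k)

inv-unique : ∀ k x → x * ι (suc k) ≡ 1ℚ → inv k ≡ x
inv-unique k x eq = begin
  inv k                   ≡⟨ *-identityʳ (inv k) ⟨
  inv k * 1ℚ              ≡⟨ cong (inv k *_) eq ⟨
  inv k * (x * ι (suc k)) ≡⟨ solve 3 (λ i x n → i :* (x :* n) := (i :* n) :* x) refl (inv k) x (ι (suc k)) ⟩
  inv k * ι (suc k) * x   ≡⟨ cong (_* x) (inv-inverse k) ⟩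
  1ℚ * x                  ≡⟨ *-identityˡ x ⟩
  x                       ∎
  where open ≡-Reasoning

ι*2 : ∀ m → ι (m ℕ.* 2) ≡ ι m * 2ℚ
ι*2 m = ι-* m 2

inv-even : ∀ m → inv (m ℕ.* 2) * (1ℚ + ι m * 2ℚ) ≡ 1ℚ
inv-even m = trans (cong (λ x → inv (m ℕ.* 2) * (1ℚ + x)) (sym (ι*2 m))) (inv-inverse′ (m ℕ.* 2))

inv-odd : ∀ m → inv (suc (m ℕ.* 2)) ≡ ½ * inv m
inv-odd m = inv-unique (suc (m ℕ.* 2)) (½ * inv m) (begin
  ½ * inv m * ι (suc m ℕ.* 2)  ≡⟨ cong (½ * inv m *_) (ι*2 (suc m)) ⟩
  ½ * inv m * (ι (suc m) * 2ℚ) ≡⟨ solve 2 (λ i n → con ½ :* i :* (n :* con 2ℚ) := i :* n) refl (inv m) (ι (suc m)) ⟩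
  inv m * ι (suc m)            ≡⟨ inv-inverse m ⟩
  1ℚ                           ∎)
  where open ≡-Reasoning

-- With `ι` eliminated, later inequalities become polynomial in two consecutive reciprocals.
inv-suc : ∀ k → inv (suc k) ≡ inv k * (1ℚ - inv (suc k))
inv-suc k = begin
  j                 ≡⟨ *-identityʳ j ⟨
  j * 1ℚ            ≡⟨ cong (j *_) (inv-inverse k) ⟨
  j * (i * n)       ≡⟨ solve 3 (λ i j n → j :* (i :* n) := i :* (j :* (con 1ℚ :+ n) :- j)) refl i j n ⟩
  i * (j * (1ℚ + n) - j) ≡⟨ cong (λ x → i * (x - j)) (inv-inverse′ (suc k)) ⟩
  i * (1ℚ - j) ∎
  where
  open ≡-Reasoning
  i = inv k
  j = inv (suc k)
  n = ι (suc k)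

-- Order and monotonicity in `ℚ`.

0≤inv : ∀ k → 0ℚ ≤ℚ inv k
0≤inv k = nonNegative⁻¹ (inv k) {{normalize-nonNeg 1 (suc k)}}

fromℚᵘ-mono-< : ∀ {p q} → p ℚᵘ.< q → fromℚᵘ p < fromℚᵘ q
fromℚᵘ-mono-< {p} {q} p<q = toℚᵘ-cancel-< (ℚᵘ.<-respˡ-≃ (ℚᵘ.≃-sym (toℚᵘ-fromℚᵘ p))
  (ℚᵘ.<-respʳ-≃ (ℚᵘ.≃-sym (toℚᵘ-fromℚᵘ q)) p<q))

inv-anti-< : ∀ {m n} → m ℕ.< n → inv n < inv m
inv-anti-< {m} {n} m<n = fromℚᵘ-mono-< {invᵘ n} {invᵘ m} (ℚᵘ.*<* (subst₂ ℤ._<_ (sym (ℤ.*-identityˡ (+ suc m)))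
  (sym (ℤ.*-identityˡ (+ suc n))) (ℤ.+<+ (ℕ.s<s m<n))))

inv-anti-≤ : ∀ {m n} → m ≤ n → inv n ≤ℚ inv m
inv-anti-≤ m≤n with ℕ.m≤n⇒m<n∨m≡n m≤n
... | inj₁ m<n  = <⇒≤ (inv-anti-< m<n)
... | inj₂ refl = ≤-refl

inv≤1 : ∀ k → inv k ≤ℚ 1ℚ
inv≤1 k = inv-anti-≤ {0} {k} ℕ.z≤n

0≤+ : ∀ {x y} → 0ℚ ≤ℚ x → 0ℚ ≤ℚ y → 0ℚ ≤ℚ x + y
0≤+ {x} {y} p q = nonNegative⁻¹ (x + y) {{nonNeg+nonNeg⇒nonNeg x {{nonNegative p}} y {{nonNegative q}}}}

0≤* : ∀ {x y} → 0ℚ ≤ℚ x → 0ℚ ≤ℚ y → 0ℚ ≤ℚ x * y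
0≤* {x} {y} p q = nonNegative⁻¹ (x * y) {{nonNeg*nonNeg⇒nonNeg x {{nonNegative p}} y {{nonNegative q}}}}

*-monoˡ : ∀ {x y} z → 0ℚ ≤ℚ z → x ≤ℚ y → z * x ≤ℚ z * y
*-monoˡ z 0≤z = *-monoˡ-≤-nonNeg z {{nonNegative 0≤z}}

*-monoʳ : ∀ {x y} z → 0ℚ ≤ℚ z → x ≤ℚ y → x * z ≤ℚ y * z
*-monoʳ z 0≤z = *-monoʳ-≤-nonNeg z {{nonNegative 0≤z}}

*-mono : ∀ {x y u v} → 0ℚ ≤ℚ x → 0ℚ ≤ℚ v → x ≤ℚ y → u ≤ℚ v → x * u ≤ℚ y * v
*-mono {x} {v = v} 0≤x 0≤v x≤y u≤v = ≤-trans (*-monoˡ x 0≤x u≤v) (*-monoʳ v 0≤v x≤y)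

-- Reduces an inequality to a ring identity with an explicit nonnegative slack `d`, which the solver
-- can check.
≤-by : ∀ {x y} d → 0ℚ ≤ℚ d → y ≡ x + d → x ≤ℚ y
≤-by {x} d 0≤d refl = ≤-trans (≤-reflexive (sym (+-identityʳ x))) (+-monoʳ-≤ x 0≤d)

≤⇒0≤- : ∀ {x y} → x ≤ℚ y → 0ℚ ≤ℚ y - x
≤⇒0≤- {x} {y} x≤y = ≤-trans (≤-reflexive (sym (+-inverseʳ x))) (+-monoˡ-≤ (- x) x≤y)

0≤½ : 0ℚ ≤ℚ ½
0≤½ = nonNegative⁻¹ ½

0≤2 : 0ℚ ≤ℚ 2ℚ
0≤2 = nonNegative⁻¹ 2ℚ

0≤1 : 0ℚ ≤ℚ 1ℚ
0≤1 = nonNegative⁻¹ 1ℚ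

-- Central binomial coefficients.

C-factorial : ∀ n → ((2 ℕ.* n) C n) ℕ.* (n ! ℕ.* n !) ≡ (2 ℕ.* n) !
C-factorial n = trans (cong (λ k → ((2 ℕ.* n) C n) ℕ.* (n ! ℕ.* k !)) (sym 2n∸n≡n))
  (trans (cong (ℕ._* (n ! ℕ.* (2 ℕ.* n ℕ.∸ n) !)) (nCk≡n!/k![n-k]! n≤2n))
    (m/n*n≡m (k![n∸k]!∣n! n≤2n)))
  where
  instance _ = n ℕ.!* (2 ℕ.* n ℕ.∸ n) !≢0
  n≤2n : n ≤ 2 ℕ.* n
  n≤2n = ℕ.m≤m+n n (n ℕ.+ 0)
  2n∸n≡n : 2 ℕ.* n ℕ.∸ n ≡ n
  2n∸n≡n = trans (ℕ.m+n∸m≡n n (n ℕ.+ 0)) (ℕ.+-identityʳ n)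

-- Multiplied by (n+1) n! n!, both sides become (2n+2)!.
C-recurrence : ∀ n → ((2 ℕ.* suc n) C suc n) ℕ.* suc n ≡ 2 ℕ.* suc (2 ℕ.* n) ℕ.* ((2 ℕ.* n) C n)
C-recurrence n = ℕ.*-cancelʳ-≡ _ _ (suc n ℕ.* (n ! ℕ.* n !)) (begin
  D′ ℕ.* suc n ℕ.* (suc n ℕ.* (n ! ℕ.* n !))
    ≡⟨ solveₙ 3 (λ d m f → d :*ₙ m :*ₙ (m :*ₙ (f :*ₙ f)) :=ₙ d :*ₙ ((m :*ₙ f) :*ₙ (m :*ₙ f))) refl D′ (suc n) (n !) ⟩
  D′ ℕ.* (suc n ! ℕ.* suc n !)  ≡⟨ C-factorial (suc n) ⟩
  (2 ℕ.* suc n) !               ≡⟨ cong _! (ℕ.*-suc 2 n) ⟩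
  suc (suc (2 ℕ.* n)) ℕ.* (suc (2 ℕ.* n) ℕ.* (2 ℕ.* n) !)
    ≡⟨ cong₂ (λ x y → x ℕ.* (suc (2 ℕ.* n) ℕ.* y)) (sym (ℕ.*-suc 2 n)) (sym (C-factorial n)) ⟩
  2 ℕ.* suc n ℕ.* (suc (2 ℕ.* n) ℕ.* (D ℕ.* (n ! ℕ.* n !)))
    ≡⟨ solveₙ 4 (λ m k d f → conₙ 2 :*ₙ m :*ₙ (k :*ₙ (d :*ₙ f)) :=ₙ conₙ 2 :*ₙ k :*ₙ d :*ₙ (m :*ₙ f)) refl (suc n) (suc (2 ℕ.* n)) D (n ! ℕ.* n !) ⟩
  2 ℕ.* suc (2 ℕ.* n) ℕ.* D ℕ.* (suc n ℕ.* (n ! ℕ.* n !)) ∎)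
  where
  open ≡-Reasoning
  open ℕS.+-*-Solver using () renaming (solve to solveₙ; _:*_ to _:*ₙ_; _:=_ to _:=ₙ_; con to conₙ)
  D D′ : ℕ
  D = (2 ℕ.* n) C n
  D′ = (2 ℕ.* suc n) C suc n
  instance
    _ = n ℕ.!* n !≢0
    _ = ℕ.m*n≢0 (suc n) (n ! ℕ.* n !)

-- Defined by the ratio a(n+1)/a(n) = (2n+1)/(2n+2), so that sign, monotonicity and decay follow by
-- induction without binomial coefficients.
a : ℕ → ℚ
a zero    = 1ℚ
a (suc n) = a n * (1ℚ - ½ * inv n)

a≡C/4^ : ∀ n → ι ((2 ℕ.* n) C n) * powQ (+ 1 / 4) n ≡ a n
a≡C/4^ zero = refl
a≡C/4^ (suc n) = begin
  d′ * (q * w)             ≡⟨ cong (_* (q * w)) (trans (sym (*-identityʳ d′)) (cong (d′ *_) (sym (inv-inverse n)))) ⟩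
  d′ * (i * ι (suc n)) * (q * w)
    ≡⟨ solve 5 (λ d i n q w → d :* (i :* n) :* (q :* w) := (d :* n) :* i :* (q :* w)) refl d′ i (ι (suc n)) q w ⟩
  (d′ * ι (suc n)) * i * (q * w)
    ≡⟨ cong (λ x → x * i * (q * w)) rec ⟩
  2ℚ * (1ℚ + 2ℚ * ι n) * d * i * (q * w)
    ≡⟨ solve 4 (λ d i n w → con 2ℚ :* (con 1ℚ :+ con 2ℚ :* n) :* d :* i :* (con q :* w)
                 := (d :* w) :* (i :* (con 1ℚ :+ n) :- con ½ :* i)) refl d i (ι n) w ⟩
  d * w * (i * (1ℚ + ι n) - ½ * i)
    ≡⟨ cong₂ (λ x y → x * (y - ½ * i)) (a≡C/4^ n) (inv-inverse′ n) ⟩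
  a n * (1ℚ - ½ * i) ∎
  where
  open ≡-Reasoning
  q = + 1 / 4
  w = powQ q n
  d = ι ((2 ℕ.* n) C n)
  d′ = ι ((2 ℕ.* suc n) C suc n)
  i = inv n
  rec : d′ * ι (suc n) ≡ 2ℚ * (1ℚ + 2ℚ * ι n) * d
  rec = begin
    d′ * ι (suc n) ≡⟨ ι-* ((2 ℕ.* suc n) C suc n) (suc n) ⟨
    ι (((2 ℕ.* suc n) C suc n) ℕ.* suc n) ≡⟨ cong ι (C-recurrence n) ⟩
    ι (2 ℕ.* suc (2 ℕ.* n) ℕ.* ((2 ℕ.* n) C n)) ≡⟨ ι-* (2 ℕ.* suc (2 ℕ.* n)) ((2 ℕ.* n) C n) ⟩
    ι (2 ℕ.* suc (2 ℕ.* n)) * d ≡⟨ cong (_* d) (ι-* 2 (suc (2 ℕ.* n))) ⟩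
    2ℚ * ι (suc (2 ℕ.* n)) * d ≡⟨ cong (λ x → 2ℚ * x * d) (trans (ι-suc (2 ℕ.* n)) (cong (λ x → 1ℚ + x) (ι-* 2 n))) ⟩
    2ℚ * (1ℚ + 2ℚ * ι n) * d ∎

-- The kernel `c` and its telescoping certificate.

-- c n m = n! m! / (n + m)!
c : ℕ → ℕ → ℚ
c n zero    = 1ℚ
c n (suc m) = c n m * (ι (suc m) * inv (n ℕ.+ m))

-- The kernel is symmetric but defined by recursion on `m` alone. In the induction on `m` the
-- factors 1/(n+m+1) and 1/(n+m+2) merely change places.
c-sucˡ : ∀ n m → c (suc n) m ≡ c n m * (ι (suc n) * inv (n ℕ.+ m))
c-sucˡ n zero = sym (begin
  1ℚ * (ι (suc n) * inv (n ℕ.+ 0)) ≡⟨ cong (λ k → 1ℚ * (ι (suc n) * inv k)) (ℕ.+-identityʳ n) ⟩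
  1ℚ * (ι (suc n) * inv n) ≡⟨ solve 2 (λ x i → con 1ℚ :* (x :* i) := i :* x) refl (ι (suc n)) (inv n) ⟩
  inv n * ι (suc n) ≡⟨ inv-inverse n ⟩
  1ℚ ∎)
  where open ≡-Reasoning
c-sucˡ n (suc m) = begin
  c (suc n) m * (M * inv (suc n ℕ.+ m)) ≡⟨ cong₂ (λ x k → x * (M * inv k)) (c-sucˡ n m) (sym (ℕ.+-suc n m)) ⟩
  c n m * (N * j) * (M * k) ≡⟨ solve 5 (λ c N M j k → c :* (N :* j) :* (M :* k) := c :* (M :* j) :* (N :* k)) refl (c n m) N M j k ⟩
  c n m * (M * j) * (N * k) ∎
  where
  open ≡-Reasoning
  N = ι (suc n)
  M = ι (suc m)
  j = inv (n ℕ.+ m)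
  k = inv (n ℕ.+ suc m)

-- Found by Gosper's algorithm: g n m - g (n + 1) m = a n * c n m / (n + m + 1).
g : ℕ → ℕ → ℚ
g n m = a n * c n m * (2ℚ * inv (m ℕ.* 2))

gosper-step : ∀ n m → g n m ≡ a n * c n m * inv (n ℕ.+ m) + g (suc n) m
gosper-step n m = begin
  A * D * (2ℚ * j)
    ≡⟨ solve 3 (λ A D j → A :* D :* (con 2ℚ :* j) := A :* D :* (con 2ℚ :* j) :* (con 1ℚ :* con 1ℚ)) refl A D j ⟩
  A * D * (2ℚ * j) * (1ℚ * 1ℚ)
    -- Two disguised factors 1 make the claim a polynomial identity; the products of a reciprocal
    -- with its denominator are then contracted again.
    ≡⟨ cong₂ (λ x y → A * D * (2ℚ * j) * (x * y)) (sym (inv-inverse′ n)) (sym inv-n+m) ⟩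
  A * D * (2ℚ * j) * (i * (1ℚ + N) * (k * (1ℚ + (N + M))))
    ≡⟨ solve 7 (λ A D i j k N M → A :* D :* (con 2ℚ :* j) :* (i :* (con 1ℚ :+ N) :* (k :* (con 1ℚ :+ (N :+ M))))
        := i :* (con 1ℚ :+ N) :* (A :* D :* k :* (j :* (con 1ℚ :+ M :* con 2ℚ)))
           :+ (A :* (i :* (con 1ℚ :+ N) :* con 2ℚ :- i)) :* (D :* ((con 1ℚ :+ N) :* k)) :* j)
        refl A D i j k N M ⟩
  i * (1ℚ + N) * (A * D * k * (j * (1ℚ + M * 2ℚ))) + A * (i * (1ℚ + N) * 2ℚ - i) * (D * ((1ℚ + N) * k)) * j
    ≡⟨ cong₂ (λ x y → x * (A * D * k * y) + A * (x * 2ℚ - i) * (D * ((1ℚ + N) * k)) * j) (inv-inverse′ n) (inv-even m) ⟩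
  1ℚ * (A * D * k * 1ℚ) + A * (1ℚ * 2ℚ - i) * (D * ((1ℚ + N) * k)) * j
    ≡⟨ solve 6 (λ A D i j k N → con 1ℚ :* (A :* D :* k :* con 1ℚ) :+ A :* (con 1ℚ :* con 2ℚ :- i) :* (D :* ((con 1ℚ :+ N) :* k)) :* j
        := A :* D :* k :+ A :* (con 1ℚ :- con ½ :* i) :* (D :* ((con 1ℚ :+ N) :* k)) :* (con 2ℚ :* j)) refl A D i j k N ⟩
  A * D * k + A * (1ℚ - ½ * i) * (D * ((1ℚ + N) * k)) * (2ℚ * j)
    ≡⟨ cong (λ x → A * D * k + A * (1ℚ - ½ * i) * x * (2ℚ * j))
         (sym (trans (c-sucˡ n m) (cong (λ x → D * (x * k)) (ι-suc n)))) ⟩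
  A * D * k + g (suc n) m ∎
  where
  open ≡-Reasoning
  A = a n
  D = c n m
  i = inv n
  j = inv (m ℕ.* 2)
  k = inv (n ℕ.+ m)
  N = ι n
  M = ι m
  inv-n+m : k * (1ℚ + (N + M)) ≡ 1ℚ
  inv-n+m = trans (cong (λ x → k * (1ℚ + x)) (sym (ι-+ n m))) (inv-inverse′ (n ℕ.+ m))

-- Difference equations of the truncated sums.

∑ : ℕ → (ℕ → ℚ) → ℚ
∑ zero    f = 0ℚ
∑ (suc n) f = ∑ n f + f n

sumFrom1≡∑ : ∀ n f → sumFrom1 n f ≡ ∑ n (λ k → f (suc k))
sumFrom1≡∑ zero    f = refl
sumFrom1≡∑ (suc n) f = cong (_+ f (suc n)) (sumFrom1≡∑ n f)

c-sucʳ : ∀ l m → inv m * c (suc l) (suc m) ≡ c (suc l) m * inv (suc l ℕ.+ m)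
c-sucʳ l m = begin
  inv m * (D * (M * k)) ≡⟨ solve 4 (λ i D M k → i :* (D :* (M :* k)) := i :* M :* (D :* k)) refl (inv m) D M k ⟩
  inv m * M * (D * k)   ≡⟨ cong (_* (D * k)) (inv-inverse m) ⟩
  1ℚ * (D * k)          ≡⟨ *-identityˡ (D * k) ⟩
  D * k                 ∎
  where
  open ≡-Reasoning
  D = c (suc l) m
  M = ι (suc m)
  k = inv (suc l ℕ.+ m)

-- With n = l+1 this is 1 - (m+1)/(n+m+1) = n/(n+m+1), whose numerator cancels the factor 1/n.
c-difference : ∀ l m → c (suc l) m * inv l ≡ c (suc l) (suc m) * inv l + c (suc l) m * inv (suc l ℕ.+ m)
c-difference l m = begin
  D * i                      ≡⟨ *-identityʳ (D * i) ⟨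
  D * i * 1ℚ                 ≡⟨ cong (D * i *_) inv-l+m ⟨
  D * i * (k * (L + M))      ≡⟨ solve 5 (λ D i k L M → D :* i :* (k :* (L :+ M)) := D :* (M :* k) :* i :+ D :* k :* (i :* L)) refl D i k L M ⟩
  D * (M * k) * i + D * k * (i * L) ≡⟨ cong (λ x → D * (M * k) * i + D * k * x) (inv-inverse l) ⟩
  D * (M * k) * i + D * k * 1ℚ ≡⟨ cong (λ x → D * (M * k) * i + x) (*-identityʳ (D * k)) ⟩
  D * (M * k) * i + D * k    ∎
  where
  open ≡-Reasoning
  D = c (suc l) m
  L = ι (suc l)
  M = ι (suc m)
  i = inv l
  k = inv (suc l ℕ.+ m)
  inv-l+m : k * (L + M) ≡ 1ℚ
  inv-l+m = trans (cong (k *_) (trans (sym (ι-+ (suc l) (suc m))) (cong ι (ℕ.+-suc (suc l) m)))) (inv-inverse (suc l ℕ.+ m))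

-- The index l stands for n = l + 1:  L q N m = Σ_{1 ≤ n ≤ N} a n * c n m / n^{q+1}.
L : ℕ → ℕ → ℕ → ℚ
L q N m = ∑ N (λ l → a (suc l) * c (suc l) m * powQ (inv l) (suc q))

L-suc : ∀ q N m → L (suc q) N m ≡ L (suc q) N (suc m) + inv m * L q N (suc m)
L-suc q zero m = solve 1 (λ i → con 0ℚ := con 0ℚ :+ i :* con 0ℚ) refl (inv m)
L-suc q (suc N) m = begin
  L (suc q) N m + A * D * (i * P)
    ≡⟨ cong₂ _+_ (L-suc q N m) (solve 4 (λ A D i P → A :* D :* (i :* P) := A :* (D :* i) :* P) refl A D i P) ⟩
  L (suc q) N (suc m) + j * L q N (suc m) + A * (D * i) * P
    -- `c-difference` uses up one factor 1/n, and `c-sucʳ` trades 1/(n+m+1) for 1/(m+1), which does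
    -- not depend on n and leaves the sum.
    ≡⟨ cong (λ x → L (suc q) N (suc m) + j * L q N (suc m) + A * x * P)
         (trans (c-difference N m) (cong (λ x → D′ * i + x) (sym (c-sucʳ N m)))) ⟩
  L (suc q) N (suc m) + j * L q N (suc m) + A * (D′ * i + j * D′) * P
    ≡⟨ solve 7 (λ x y A D i j P → x :+ j :* y :+ A :* (D :* i :+ j :* D) :* P
        := x :+ A :* D :* (i :* P) :+ j :* (y :+ A :* D :* P)) refl (L (suc q) N (suc m)) (L q N (suc m)) A D′ i j P ⟩
  L (suc q) N (suc m) + A * D′ * (i * P) + j * (L q N (suc m) + A * D′ * P) ∎
  where
  open ≡-Reasoning
  A = a (suc N)
  D = c (suc N) m
  D′ = c (suc N) (suc m)
  i = inv N
  j = inv m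
  P = powQ i (suc q)

-- For q = 0 the only factor 1/n is used up. What remains is the sum of a(n) c(n,m)/(n+m+1), which
-- `gosper-step` telescopes from `g 1 m` to `g (suc N) m`.
L-zero : ∀ N m → L 0 N m + g (suc N) m ≡ L 0 N (suc m) + g 1 m
L-zero zero m = refl
L-zero (suc N) m = begin
  L 0 N m + A * D * (i * 1ℚ) + g (suc (suc N)) m
    ≡⟨ solve 5 (λ x A D i y → x :+ A :* D :* (i :* con 1ℚ) :+ y := x :+ A :* (D :* i) :+ y) refl (L 0 N m) A D i (g (suc (suc N)) m) ⟩
  L 0 N m + A * (D * i) + g (suc (suc N)) m
    ≡⟨ cong (λ x → L 0 N m + A * x + g (suc (suc N)) m) (c-difference N m) ⟩
  L 0 N m + A * (D′ * i + D * k) + g (suc (suc N)) m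
    ≡⟨ solve 7 (λ x A D′ i D k y → x :+ A :* (D′ :* i :+ D :* k) :+ y := x :+ (A :* D :* k :+ y) :+ A :* D′ :* (i :* con 1ℚ))
        refl (L 0 N m) A D′ i D k (g (suc (suc N)) m) ⟩
  L 0 N m + (A * D * k + g (suc (suc N)) m) + A * D′ * (i * 1ℚ)
    ≡⟨ cong (λ x → L 0 N m + x + A * D′ * (i * 1ℚ)) (gosper-step (suc N) m) ⟨
  L 0 N m + g (suc N) m + A * D′ * (i * 1ℚ)
    ≡⟨ cong (_+ A * D′ * (i * 1ℚ)) (L-zero N m) ⟩
  L 0 N (suc m) + g 1 m + A * D′ * (i * 1ℚ)
    ≡⟨ solve 3 (λ x y z → x :+ y :+ z := x :+ z :+ y) refl (L 0 N (suc m)) (g 1 m) (A * D′ * (i * 1ℚ)) ⟩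
  L 0 N (suc m) + A * D′ * (i * 1ℚ) + g 1 m ∎
  where
  open ≡-Reasoning
  A = a (suc N)
  D = c (suc N) m
  D′ = c (suc N) (suc m)
  i = inv N
  k = inv (suc N ℕ.+ m)

c-0 : ∀ m → c 0 m ≡ 1ℚ
c-0 zero = refl
c-0 (suc m) = begin
  c 0 m * (ι (suc m) * inv m) ≡⟨ cong₂ _*_ (c-0 m) (trans (*-comm (ι (suc m)) (inv m)) (inv-inverse m)) ⟩
  1ℚ * 1ℚ                     ∎
  where open ≡-Reasoning

-- The value is 2/(2m+1) - 2/(2m+2), so `E p m * g 1 m` will be minus twice the two zeta terms at
-- 2m+1 and 2m+2.
g-1 : ∀ m → g 1 m ≡ inv m * inv (m ℕ.* 2)
g-1 m = begin
  ½ * c 1 m * (2ℚ * j) ≡⟨ cong (λ x → ½ * x * (2ℚ * j)) (trans (c-sucˡ 0 m) (cong (_* (1ℚ * inv m)) (c-0 m))) ⟩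
  ½ * (1ℚ * (1ℚ * inv m)) * (2ℚ * j)
    ≡⟨ solve 2 (λ i j → con ½ :* (con 1ℚ :* (con 1ℚ :* i)) :* (con 2ℚ :* j) := i :* j) refl (inv m) j ⟩
  inv m * j ∎
  where
  open ≡-Reasoning
  j = inv (m ℕ.* 2)

-- Summation by parts with elementary symmetric polynomials.

-- E p m is the p-th elementary symmetric polynomial of 1, 1/2, …, 1/m.
E : ℕ → ℕ → ℚ
E zero    m       = 1ℚ
E (suc p) zero    = 0ℚ
E (suc p) (suc m) = E (suc p) m + inv m * E p m

-- S p q N m = Σ_{j ≤ p} E j m * L (q + p - j) N m, the result of p summations by parts.
S : ℕ → ℕ → ℕ → ℕ → ℚ
S zero    q N m = L q N m
S (suc p) q N m = S p (suc q) N m + E (suc p) m * L q N m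

-- In the induction on `p`, `L-suc` turns the leftover difference of level q+1 into `i * e * l′`.
-- This is the increment from `E (suc p) m` to `E (suc p) (suc m)`, so only a difference at level
-- `q` survives.
S-difference : ∀ p q N m → S p q N m ≡ S p q N (suc m) + E p m * (L q N m - L q N (suc m))
S-difference zero q N m = solve 2 (λ x y → x := y :+ con 1ℚ :* (x :- y)) refl (L q N m) (L q N (suc m))
S-difference (suc p) q N m = begin
  S p (suc q) N m + e′ * l
    ≡⟨ cong (_+ e′ * l) (S-difference p (suc q) N m) ⟩
  s + e * (L (suc q) N m - l₁) + e′ * l
    ≡⟨ cong (λ x → s + e * (x - l₁) + e′ * l) (L-suc q N m) ⟩
  s + e * (l₁ + i * l′ - l₁) + e′ * l
    ≡⟨ solve 7 (λ s e e′ l₁ i l l′ → s :+ e :* (l₁ :+ i :* l′ :- l₁) :+ e′ :* l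
        := s :+ (e′ :+ i :* e) :* l′ :+ e′ :* (l :- l′)) refl s e e′ l₁ i l l′ ⟩
  s + (e′ + i * e) * l′ + e′ * (l - l′) ∎
  where
  open ≡-Reasoning
  s = S p (suc q) N (suc m)
  e = E p m
  e′ = E (suc p) m
  i = inv m
  l = L q N m
  l′ = L q N (suc m)
  l₁ = L (suc q) N (suc m)

-- At m = 0 every `E j 0` with j > 0 vanishes, leaving the summand j = 0.
S-0 : ∀ p q N → S p q N 0 ≡ L (p ℕ.+ q) N 0
S-0 zero q N = refl
S-0 (suc p) q N = begin
  S p (suc q) N 0 + 0ℚ * L q N 0 ≡⟨ solve 2 (λ x y → x :+ con 0ℚ :* y := x) refl (S p (suc q) N 0) (L q N 0) ⟩
  S p (suc q) N 0                ≡⟨ S-0 p (suc q) N ⟩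
  L (p ℕ.+ suc q) N 0            ≡⟨ cong (λ x → L x N 0) (ℕ.+-suc p q) ⟩
  L (suc p ℕ.+ q) N 0            ∎
  where open ≡-Reasoning

-- Zeta partial sums by parity.

negOnePow-even : ∀ m → negOnePow (m ℕ.* 2) ≡ 1ℚ
negOnePow-even zero = refl
negOnePow-even (suc m) = cong (λ x → - (- x)) (negOnePow-even m)

-- The pattern-matching summand of `hatTail` carries the upper limit as a parameter, so the two sums
-- do not agree definitionally. In terms of `∑` it is evaluated only at successors, where both
-- reduce to the same body.
hatTail-suc : ∀ p n → hatTail (suc p) (suc (suc n)) ≡
  hatTail (suc p) (suc n) + (1ℚ + negOnePow (suc n)) * inv n * hatTail p (suc n)
hatTail-suc p n = cong (_+ (1ℚ + negOnePow (suc n)) * inv n * hatTail p (suc n))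
  (trans (sumFrom1≡∑ n _) (sym (sumFrom1≡∑ n _)))

-- The weight 1 + (-1)^k vanishes at odd k, and at k = 2(m+1) the quotient by k is 1/(m+1). Since
-- `hatTail` sums strictly below its argument, 2m+1 and 2m+2 see the same even indices.
hatTail-odd : ∀ p m → hatTail p (suc (m ℕ.* 2)) ≡ E p m
hatTail-even : ∀ p m → hatTail p (suc (suc (m ℕ.* 2))) ≡ E p m
hatTail-odd zero m = refl
hatTail-odd (suc p) zero = refl
hatTail-odd (suc p) (suc m) = begin
  hatTail (suc p) (suc (suc (suc (m ℕ.* 2))))
    ≡⟨ hatTail-suc p (suc (m ℕ.* 2)) ⟩
  hatTail (suc p) (suc (suc (m ℕ.* 2))) + (1ℚ + negOnePow (suc m ℕ.* 2)) * inv (suc (m ℕ.* 2)) * hatTail p (suc (suc (m ℕ.* 2)))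
    ≡⟨ cong₂ _+_ (hatTail-even (suc p) m) (cong₂ (λ x y → x * y * hatTail p (suc (suc (m ℕ.* 2))))
         (cong (λ x → 1ℚ + x) (negOnePow-even (suc m))) (inv-odd m)) ⟩
  E (suc p) m + (1ℚ + 1ℚ) * (½ * inv m) * hatTail p (suc (suc (m ℕ.* 2)))
    ≡⟨ cong (λ x → E (suc p) m + (1ℚ + 1ℚ) * (½ * inv m) * x) (hatTail-even p m) ⟩
  E (suc p) m + (1ℚ + 1ℚ) * (½ * inv m) * E p m
    ≡⟨ solve 3 (λ x i y → x :+ (con 1ℚ :+ con 1ℚ) :* (con ½ :* i) :* y := x :+ i :* y) refl (E (suc p) m) (inv m) (E p m) ⟩
  E (suc p) m + inv m * E p m ∎
  where open ≡-Reasoning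
hatTail-even zero m = refl
hatTail-even (suc p) m = begin
  hatTail (suc p) (suc (suc (m ℕ.* 2)))
    ≡⟨ hatTail-suc p (m ℕ.* 2) ⟩
  hatTail (suc p) (suc (m ℕ.* 2)) + (1ℚ + - negOnePow (m ℕ.* 2)) * i * h
    ≡⟨ cong₂ (λ x y → x + (1ℚ + - y) * i * h) (hatTail-odd (suc p) m) (negOnePow-even m) ⟩
  E (suc p) m + (1ℚ + - 1ℚ) * i * h
    ≡⟨ solve 3 (λ x i h → x :+ (con 1ℚ :+ :- con 1ℚ) :* i :* h := x) refl (E (suc p) m) i h ⟩
  E (suc p) m ∎
  where
  open ≡-Reasoning
  i = inv (m ℕ.* 2)
  h = hatTail p (suc (m ℕ.* 2))

zeta-suc : ∀ p n → zetaBar1Hat1Partial p (suc n) ≡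
  zetaBar1Hat1Partial p n + negOnePow (suc n) * inv n * hatTail p (suc n)
zeta-suc p n = cong (_+ negOnePow (suc n) * inv n * hatTail p (suc n))
  (trans (sumFrom1≡∑ n _) (sym (sumFrom1≡∑ n _)))

zeta-odd : ∀ p m → zetaBar1Hat1Partial p (suc (m ℕ.* 2)) ≡ zetaBar1Hat1Partial p (m ℕ.* 2) - inv (m ℕ.* 2) * E p m
zeta-odd p m = begin
  zetaBar1Hat1Partial p (suc (m ℕ.* 2)) ≡⟨ zeta-suc p (m ℕ.* 2) ⟩
  z + - negOnePow (m ℕ.* 2) * i * hatTail p (suc (m ℕ.* 2))
    ≡⟨ cong₂ (λ x y → z + - x * i * y) (negOnePow-even m) (hatTail-odd p m) ⟩
  z + - 1ℚ * i * E p m ≡⟨ solve 3 (λ z i e → z :+ :- con 1ℚ :* i :* e := z :- i :* e) refl z i (E p m) ⟩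
  z - i * E p m ∎
  where
  open ≡-Reasoning
  i = inv (m ℕ.* 2)
  z = zetaBar1Hat1Partial p (m ℕ.* 2)

zeta-even : ∀ p m → 2ℚ * zetaBar1Hat1Partial p (suc m ℕ.* 2) ≡ 2ℚ * zetaBar1Hat1Partial p (m ℕ.* 2) - E p m * g 1 m
zeta-even p m = begin
  2ℚ * zetaBar1Hat1Partial p (suc (suc (m ℕ.* 2)))
    ≡⟨ cong (2ℚ *_) (trans (zeta-suc p (suc (m ℕ.* 2))) (cong (_+ negOnePow (suc m ℕ.* 2) * inv (suc (m ℕ.* 2)) * hatTail p (suc (suc (m ℕ.* 2)))) (zeta-odd p m))) ⟩
  2ℚ * (z - j * e + negOnePow (suc m ℕ.* 2) * inv (suc (m ℕ.* 2)) * hatTail p (suc (suc (m ℕ.* 2))))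
    ≡⟨ cong₂ (λ x y → 2ℚ * (z - j * e + x * inv (suc (m ℕ.* 2)) * y)) (negOnePow-even (suc m)) (hatTail-even p m) ⟩
  2ℚ * (z - j * e + 1ℚ * inv (suc (m ℕ.* 2)) * e)
    ≡⟨ cong (λ x → 2ℚ * (z - j * e + 1ℚ * x * e)) (inv-odd m) ⟩
  2ℚ * (z - j * e + 1ℚ * (½ * i) * e)
    ≡⟨ solve 4 (λ z e i j → con 2ℚ :* (z :- j :* e :+ con 1ℚ :* (con ½ :* i) :* e)
         := con 2ℚ :* z :- e :* (con 2ℚ :* j :* con 1ℚ :- i :* con 1ℚ)) refl z e i j ⟩
  2ℚ * z - e * (2ℚ * j * 1ℚ - i * 1ℚ)
    -- Brings 2j - i over a common denominator: each 1 becomes the other reciprocal times its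
    -- denominator, and the terms in `ι m` cancel.
    ≡⟨ cong₂ (λ x y → 2ℚ * z - e * (2ℚ * j * x - i * y)) (inv-inverse′ m) (inv-even m) ⟨
  2ℚ * z - e * (2ℚ * j * (i * (1ℚ + ι m)) - i * (j * (1ℚ + ι m * 2ℚ)))
    ≡⟨ solve 5 (λ z e i j m → con 2ℚ :* z :- e :* (con 2ℚ :* j :* (i :* (con 1ℚ :+ m)) :- i :* (j :* (con 1ℚ :+ m :* con 2ℚ)))
         := con 2ℚ :* z :- e :* (i :* j)) refl z e i j (ι m) ⟩
  2ℚ * z - e * (i * j) ≡⟨ cong (λ x → 2ℚ * z - e * x) (g-1 m) ⟨
  2ℚ * z - e * g 1 m ∎
  where
  open ≡-Reasoning
  z = zetaBar1Hat1Partial p (m ℕ.* 2)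
  e = E p m
  i = inv m
  j = inv (m ℕ.* 2)

-- The exact identity between partial sums.

lhsTerm≡ : ∀ p k → lhsTerm p k ≡ a (suc k) * powQ (inv k) (suc p)
lhsTerm≡ p k = trans (sym (*-assoc (ι ((2 ℕ.* suc k) C suc k)) (powQ (+ 1 / 4) (suc k)) (powQ (inv k) (suc p))))
  (cong (_* powQ (inv k) (suc p)) (a≡C/4^ (suc k)))

lhsPartial-suc : ∀ p n → lhsPartial p (suc n) ≡ lhsPartial p n + a (suc n) * powQ (inv n) (suc p)
lhsPartial-suc p n = cong₂ _+_ (trans (sumFrom1≡∑ n _) (sym (sumFrom1≡∑ n _))) (lhsTerm≡ p n)

lhsPartial≡L : ∀ p N → lhsPartial p N ≡ L p N 0
lhsPartial≡L p zero = refl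
lhsPartial≡L p (suc N) = trans (lhsPartial-suc p N)
  (cong₂ (λ x y → x + y * powQ (inv N) (suc p)) (lhsPartial≡L p N) (sym (*-identityʳ (a (suc N)))))

-- Induction on `M`. One step changes the left side by `E p M` times `g (suc N) M - g 1 M`. By
-- `L-zero` this is the change of `S` computed in `S-difference`.
lhs+2zeta≡S : ∀ p N M →
  lhsPartial p N + 2ℚ * zetaBar1Hat1Partial p (M ℕ.* 2) + ∑ M (λ m → E p m * g (suc N) m) ≡ S p 0 N M
lhs+2zeta≡S p N zero = begin
  lhsPartial p N + 0ℚ + 0ℚ ≡⟨ solve 1 (λ x → x :+ con 0ℚ :+ con 0ℚ := x) refl (lhsPartial p N) ⟩
  lhsPartial p N           ≡⟨ lhsPartial≡L p N ⟩
  L p N 0                  ≡⟨ cong (λ q → L q N 0) (ℕ.+-identityʳ p) ⟨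
  L (p ℕ.+ 0) N 0          ≡⟨ S-0 p 0 N ⟨
  S p 0 N 0                ∎
  where open ≡-Reasoning
lhs+2zeta≡S p N (suc M) = begin
  x + 2ℚ * zetaBar1Hat1Partial p (suc M ℕ.* 2) + (r + e * g₂) ≡⟨ cong (λ y → x + y + (r + e * g₂)) (zeta-even p M) ⟩
  x + (2ℚ * z - e * g₁) + (r + e * g₂)
    ≡⟨ solve 6 (λ x z r e g₁ g₂ → x :+ (con 2ℚ :* z :- e :* g₁) :+ (r :+ e :* g₂)
         := (x :+ con 2ℚ :* z :+ r) :- e :* (g₁ :- g₂)) refl x z r e g₁ g₂ ⟩
  (x + 2ℚ * z + r) - e * (g₁ - g₂) ≡⟨ cong₂ (λ x y → x - e * y) (trans (lhs+2zeta≡S p N M) (S-difference p 0 N M)) g₁-g₂ ⟩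
  S p 0 N (suc M) + e * (l - l′) - e * (l - l′)
    ≡⟨ solve 2 (λ s y → s :+ y :- y := s) refl (S p 0 N (suc M)) (e * (l - l′)) ⟩
  S p 0 N (suc M) ∎
  where
  open ≡-Reasoning
  x = lhsPartial p N
  z = zetaBar1Hat1Partial p (M ℕ.* 2)
  r = ∑ M (λ m → E p m * g (suc N) m)
  e = E p M
  g₁ = g 1 M
  g₂ = g (suc N) M
  l = L 0 N M
  l′ = L 0 N (suc M)
  g₁-g₂ : g₁ - g₂ ≡ l - l′
  g₁-g₂ = begin
    g₁ - g₂            ≡⟨ solve 3 (λ x y z → x :- y := z :+ x :- (y :+ z)) refl g₁ g₂ l′ ⟩
    l′ + g₁ - (g₂ + l′) ≡⟨ cong (λ x → x - (g₂ + l′)) (L-zero N M) ⟨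
    l + g₂ - (g₂ + l′) ≡⟨ solve 3 (λ x y z → x :+ y :- (y :+ z) := x :- z) refl l g₂ l′ ⟩
    l - l′ ∎

-- Estimates for `a`, `c` and sums of `c`.

∑-nonneg : ∀ n {f} → (∀ k → 0ℚ ≤ℚ f k) → 0ℚ ≤ℚ ∑ n f
∑-nonneg zero    0≤f = ≤-refl
∑-nonneg (suc n) 0≤f = 0≤+ (∑-nonneg n 0≤f) (0≤f n)

∑-mono : ∀ n {f h} → (∀ k → f k ≤ℚ h k) → ∑ n f ≤ℚ ∑ n h
∑-mono zero    f≤h = ≤-refl
∑-mono (suc n) f≤h = +-mono-≤ (∑-mono n f≤h) (f≤h n)

∑-*ˡ : ∀ n x f → ∑ n (λ k → x * f k) ≡ x * ∑ n f
∑-*ˡ zero x f = sym (*-zeroʳ x)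
∑-*ˡ (suc n) x f = trans (cong (_+ x * f n) (∑-*ˡ n x f)) (sym (*-distribˡ-+ x (∑ n f) (f n)))

∑-telescope : ∀ n (f : ℕ → ℚ) → ∑ n (λ k → f k - f (suc k)) ≡ f 0 - f n
∑-telescope zero    f = sym (+-inverseʳ (f 0))
∑-telescope (suc n) f = trans (cong (_+ (f n - f (suc n))) (∑-telescope n f))
  (solve 3 (λ x y z → x :- y :+ (y :- z) := x :- z) refl (f 0) (f n) (f (suc n)))

0≤ι : ∀ n → 0ℚ ≤ℚ ι n
0≤ι n = nonNegative⁻¹ (ι n) {{normalize-nonNeg n 1}}

0≤1-½inv : ∀ n → 0ℚ ≤ℚ 1ℚ - ½ * inv n
0≤1-½inv n = ≤-trans (0≤+ 0≤½ (0≤* 0≤½ (≤⇒0≤- (inv≤1 n))))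
  (≤-reflexive (solve 1 (λ i → con ½ :+ con ½ :* (con 1ℚ :- i) := con 1ℚ :- con ½ :* i) refl (inv n)))

0≤a : ∀ n → 0ℚ ≤ℚ a n
0≤a zero    = 0≤1
0≤a (suc n) = 0≤* (0≤a n) (0≤1-½inv n)

a-decrease : ∀ n → a n - a (suc n) ≡ ½ * (a n * inv n)
a-decrease n = solve 2 (λ a i → a :- a :* (con 1ℚ :- con ½ :* i) := con ½ :* (a :* i)) refl (a n) (inv n)

a-suc≤a : ∀ n → a (suc n) ≤ℚ a n
a-suc≤a n = ≤-by (½ * (a n * inv n)) (0≤* 0≤½ (0≤* (0≤a n) (0≤inv n)))
  (solve 2 (λ a i → a := a :* (con 1ℚ :- con ½ :* i) :+ con ½ :* (a :* i)) refl (a n) (inv n))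

a-anti : ∀ {m n} → m ≤ n → a n ≤ℚ a m
a-anti {m} m≤n = go (ℕ.≤⇒≤′ m≤n)
  where
  go : ∀ {n} → m ℕ.≤′ n → a n ≤ℚ a m
  go (ℕ.≤′-reflexive refl) = ≤-refl
  go {suc n} (ℕ.≤′-step m≤n) = ≤-trans (a-suc≤a n) (go m≤n)

a≤1 : ∀ n → a n ≤ℚ 1ℚ
a≤1 n = a-anti {0} {n} ℕ.z≤n

-- With i = 1/(n+1) one has 1/(n+1) = (1 + i)/(n+2), so the induction step is (1 - i/2)²(1 + i) ≤ 1.
-- This gives the decay of `a` without square roots.
a²≤inv : ∀ n → a n * a n ≤ℚ inv n
a²≤inv zero = ≤-refl
a²≤inv (suc n) = begin
  a n * t * (a n * t)   ≡⟨ solve 2 (λ a t → a :* t :* (a :* t) := a :* a :* (t :* t)) refl (a n) t ⟩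
  a n * a n * (t * t)   ≤⟨ *-monoʳ (t * t) (0≤* 0≤t 0≤t) (a²≤inv n) ⟩
  i * (t * t)           ≡⟨ cong (_* (t * t)) i≡ ⟩
  j * (1ℚ + i) * (t * t)
    -- The slack is j i² (3 - i)/4, nonnegative because i ≤ 1.
    ≤⟨ ≤-by (j * (i * i) * (½ * (1ℚ + ½ * (1ℚ - i)))) (0≤* (0≤* (0≤inv (suc n)) (0≤* (0≤inv n) (0≤inv n)))
         (0≤* 0≤½ (0≤+ 0≤1 (0≤* 0≤½ (≤⇒0≤- (inv≤1 n))))))
       (solve 2 (λ i j → j := j :* (con 1ℚ :+ i) :* ((con 1ℚ :- con ½ :* i) :* (con 1ℚ :- con ½ :* i))
          :+ j :* (i :* i) :* (con ½ :* (con 1ℚ :+ con ½ :* (con 1ℚ :- i)))) refl i j) ⟩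
  j ∎
  where
  open ≤-Reasoning
  i = inv n
  j = inv (suc n)
  t = 1ℚ - ½ * i
  0≤t : 0ℚ ≤ℚ t
  0≤t = 0≤1-½inv n
  i≡ : i ≡ j * (1ℚ + i)
  i≡ = sym (trans (cong (_* (1ℚ + i)) (inv-suc n)) (trans
    (solve 2 (λ i j → i :* (con 1ℚ :- j) :* (con 1ℚ :+ i) := i :+ i :* (i :* (con 1ℚ :- j) :- j)) refl i j)
    (trans (cong (λ x → i + i * (x - j)) (sym (inv-suc n)))
      (solve 2 (λ i j → i :+ i :* (j :- j) := i) refl i j))))

0≤c : ∀ n m → 0ℚ ≤ℚ c n m
0≤c n zero    = 0≤1
0≤c n (suc m) = 0≤* (0≤c n m) (0≤* (0≤ι (suc m)) (0≤inv (n ℕ.+ m)))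

ι*inv≤1 : ∀ n m → ι (suc m) * inv (n ℕ.+ m) ≤ℚ 1ℚ
ι*inv≤1 n m = ≤-trans (*-monoˡ (ι (suc m)) (0≤ι (suc m)) (inv-anti-≤ (ℕ.m≤n+m m n)))
  (≤-reflexive (trans (*-comm (ι (suc m)) (inv m)) (inv-inverse m)))

c≤inv : ∀ n m → c (suc n) m ≤ℚ inv m
c≤inv n zero = ≤-refl
c≤inv n (suc m) = begin
  c (suc n) m * (ι (suc m) * k) ≤⟨ *-monoʳ (ι (suc m) * k) (0≤* (0≤ι (suc m)) (0≤inv (suc n ℕ.+ m))) (c≤inv n m) ⟩
  inv m * (ι (suc m) * k) ≡⟨ *-assoc (inv m) (ι (suc m)) k ⟨
  inv m * ι (suc m) * k   ≡⟨ cong (_* k) (inv-inverse m) ⟩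
  1ℚ * k                  ≡⟨ *-identityˡ k ⟩
  k                       ≤⟨ inv-anti-≤ (ℕ.s≤s (ℕ.m≤n+m m n)) ⟩
  inv (suc m)             ∎
  where
  open ≤-Reasoning
  k = inv (suc n ℕ.+ m)

c-suc≤c : ∀ n m → c n (suc m) ≤ℚ c n m
c-suc≤c n m = ≤-trans (*-monoˡ (c n m) (0≤c n m) (ι*inv≤1 n m)) (≤-reflexive (*-identityʳ (c n m)))

c-suc≤inv : ∀ n m → c n (suc m) ≤ℚ inv n
c-suc≤inv n zero = ≤-reflexive (trans (*-identityˡ (1ℚ * inv (n ℕ.+ 0)))
  (trans (*-identityˡ (inv (n ℕ.+ 0))) (cong inv (ℕ.+-identityʳ n))))
c-suc≤inv n (suc m) = ≤-trans (c-suc≤c n (suc m)) (c-suc≤inv n m)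

-- The term at 0 is 1, and all others are at most `c n 1` = 1/(n+1) because `c` decreases in its
-- second argument.
∑c≤ : ∀ n m → ∑ m (c n) ≤ℚ 1ℚ + ι m * inv n
∑c≤ n zero = 0≤+ 0≤1 (0≤* (0≤ι 0) (0≤inv n))
∑c≤ n (suc zero) = ≤-trans (≤-reflexive (+-identityˡ 1ℚ)) (≤-by (ι 1 * inv n) (0≤* (0≤ι 1) (0≤inv n)) refl)
∑c≤ n (suc (suc m)) = begin
  ∑ (suc m) (c n) + c n (suc m) ≤⟨ +-mono-≤ (∑c≤ n (suc m)) (c-suc≤inv n m) ⟩
  1ℚ + ι (suc m) * inv n + inv n
    ≡⟨ solve 2 (λ m i → con 1ℚ :+ m :* i :+ i := con 1ℚ :+ (con 1ℚ :+ m) :* i) refl (ι (suc m)) (inv n) ⟩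
  1ℚ + (1ℚ + ι (suc m)) * inv n ≡⟨ cong (λ x → 1ℚ + x * inv n) (ι-suc (suc m)) ⟨
  1ℚ + ι (suc (suc m)) * inv n ∎
  where open ≤-Reasoning

∑c≤2 : ∀ n m → m ≤ n → ∑ m (c n) ≤ℚ 2ℚ
∑c≤2 n zero _ = 0≤2
∑c≤2 n (suc m) m<n = ≤-trans (∑c≤ n (suc m)) (+-monoʳ-≤ 1ℚ (≤-trans
  (*-monoˡ (ι (suc m)) (0≤ι (suc m)) (inv-anti-≤ (ℕ.<⇒≤ m<n)))
  (≤-reflexive (trans (*-comm (ι (suc m)) (inv m)) (inv-inverse m)))))

-- Estimates for `L`, `E`, `S` and the remainder.

0≤pow : ∀ {x} n → 0ℚ ≤ℚ x → 0ℚ ≤ℚ powQ x n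
0≤pow zero    0≤x = 0≤1
0≤pow (suc n) 0≤x = 0≤* 0≤x (0≤pow n 0≤x)

pow≤1 : ∀ {x} n → 0ℚ ≤ℚ x → x ≤ℚ 1ℚ → powQ x n ≤ℚ 1ℚ
pow≤1 zero    0≤x x≤1 = ≤-refl
pow≤1 (suc n) 0≤x x≤1 = *-mono 0≤x 0≤1 x≤1 (pow≤1 n 0≤x x≤1)

0≤lhsTerm : ∀ q l → 0ℚ ≤ℚ a (suc l) * powQ (inv l) (suc q)
0≤lhsTerm q l = 0≤* (0≤a (suc l)) (0≤pow (suc q) (0≤inv l))

-- Keeping one factor 1/(l+1) and replacing `a (suc l)` by `a l` gives twice the decrease of `a`, so
-- sums of this bound telescope.
lhsTerm≤ : ∀ q l → a (suc l) * powQ (inv l) (suc q) ≤ℚ 2ℚ * (a l - a (suc l))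
lhsTerm≤ q l = begin
  a (suc l) * (inv l * powQ (inv l) q)
    ≤⟨ *-mono (0≤a (suc l)) (0≤* (0≤inv l) 0≤1) (a-suc≤a l)
         (*-monoˡ (inv l) (0≤inv l) (pow≤1 q (0≤inv l) (inv≤1 l))) ⟩
  a l * (inv l * 1ℚ)
    ≡⟨ solve 2 (λ a i → a :* (i :* con 1ℚ) := con 2ℚ :* (con ½ :* (a :* i))) refl (a l) (inv l) ⟩
  2ℚ * (½ * (a l * inv l)) ≡⟨ cong (2ℚ *_) (a-decrease l) ⟨
  2ℚ * (a l - a (suc l)) ∎
  where open ≤-Reasoning

0≤L : ∀ q N m → 0ℚ ≤ℚ L q N m
0≤L q N m = ∑-nonneg N λ l → 0≤* (0≤* (0≤a (suc l)) (0≤c (suc l) m)) (0≤pow (suc q) (0≤inv l))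

-- `c≤inv` extracts 1/(m+1) uniformly in n, and the rest telescopes to 2(1 - a(N)).
L≤ : ∀ q N m → L q N m ≤ℚ 2ℚ * inv m
L≤ q N m = begin
  L q N m                                      ≤⟨ ∑-mono N term≤ ⟩
  ∑ N (λ l → inv m * 2ℚ * (a l - a (suc l)))   ≡⟨ ∑-*ˡ N (inv m * 2ℚ) (λ l → a l - a (suc l)) ⟩
  inv m * 2ℚ * ∑ N (λ l → a l - a (suc l))     ≡⟨ cong (inv m * 2ℚ *_) (∑-telescope N a) ⟩
  inv m * 2ℚ * (1ℚ - a N)
    ≤⟨ ≤-by (inv m * 2ℚ * a N) (0≤* (0≤* (0≤inv m) 0≤2) (0≤a N))
       (solve 2 (λ i a → con 2ℚ :* i := i :* con 2ℚ :* (con 1ℚ :- a) :+ i :* con 2ℚ :* a) refl (inv m) (a N)) ⟩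
  2ℚ * inv m ∎
  where
  open ≤-Reasoning
  term≤ : ∀ l → a (suc l) * c (suc l) m * powQ (inv l) (suc q) ≤ℚ inv m * 2ℚ * (a l - a (suc l))
  term≤ l = begin
    a (suc l) * c (suc l) m * powQ (inv l) (suc q)
      ≡⟨ solve 3 (λ a c p → a :* c :* p := c :* (a :* p)) refl (a (suc l)) (c (suc l) m) (powQ (inv l) (suc q)) ⟩
    c (suc l) m * (a (suc l) * powQ (inv l) (suc q))
      ≤⟨ *-mono (0≤c (suc l) m) (≤-trans (0≤lhsTerm q l) (lhsTerm≤ q l)) (c≤inv l m) (lhsTerm≤ q l) ⟩
    inv m * (2ℚ * (a l - a (suc l))) ≡⟨ *-assoc (inv m) 2ℚ (a l - a (suc l)) ⟨
    inv m * 2ℚ * (a l - a (suc l)) ∎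

0≤E : ∀ p m → 0ℚ ≤ℚ E p m
0≤E zero    m       = 0≤1
0≤E (suc p) zero    = ≤-refl
0≤E (suc p) (suc m) = 0≤+ (0≤E (suc p) m) (0≤* (0≤inv m) (0≤E p m))

2^ : ℕ → ℚ
2^ k = powQ 2ℚ k

0≤2^ : ∀ k → 0ℚ ≤ℚ 2^ k
0≤2^ k = 0≤pow k 0≤2

-- With i = 1/(m+1) and j = 1/(m+2) one has j = i (1 - j), so the factor (1 - j) (2 + i) gained by
-- the left-hand side in the induction step is exactly 2 (1 - j/2), the factor gained by 2 a.
E-bound : ∀ p m → E p m * inv m ≤ℚ 2^ (suc p) * a (suc m)
E-bound zero zero = ≤-refl
E-bound zero (suc m) = begin
  1ℚ * j                      ≡⟨ trans (*-identityˡ j) (inv-suc m) ⟩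
  i * (1ℚ - j)                ≡⟨ cong (_* (1ℚ - j)) (*-identityˡ i) ⟨
  1ℚ * i * (1ℚ - j)           ≤⟨ *-monoʳ (1ℚ - j) (≤⇒0≤- (inv≤1 (suc m))) (E-bound zero m) ⟩
  2ℚ * 1ℚ * A * (1ℚ - j)
    ≤⟨ ≤-by (A * j) (0≤* (0≤a (suc m)) (0≤inv (suc m)))
       (solve 2 (λ A j → con 2ℚ :* con 1ℚ :* (A :* (con 1ℚ :- con ½ :* j)) := con 2ℚ :* con 1ℚ :* A :* (con 1ℚ :- j) :+ A :* j) refl A j) ⟩
  2ℚ * 1ℚ * (A * (1ℚ - ½ * j)) ∎
  where
  open ≤-Reasoning
  i = inv m
  j = inv (suc m)
  A = a (suc m)
E-bound (suc p) zero = ≤-trans (≤-reflexive (*-zeroˡ 1ℚ)) (0≤* (0≤2^ (suc (suc p))) (0≤a 1))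
E-bound (suc p) (suc m) = begin
  (E (suc p) m + i * E p m) * j ≡⟨ cong ((E (suc p) m + i * E p m) *_) (inv-suc m) ⟩
  (E (suc p) m + i * E p m) * (i * (1ℚ - j))
    ≡⟨ solve 4 (λ x y i t → (x :+ i :* y) :* (i :* t) := t :* (x :* i :+ i :* (y :* i))) refl (E (suc p) m) (E p m) i (1ℚ - j) ⟩
  (1ℚ - j) * (E (suc p) m * i + i * (E p m * i))
    ≤⟨ *-monoˡ (1ℚ - j) (≤⇒0≤- (inv≤1 (suc m))) (+-mono-≤ (E-bound (suc p) m) (*-monoˡ i (0≤inv m) (E-bound p m))) ⟩
  (1ℚ - j) * (2ℚ * K * A + i * (K * A))
    ≡⟨ solve 4 (λ i j K A → (con 1ℚ :- j) :* (con 2ℚ :* K :* A :+ i :* (K :* A))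
          := K :* A :* (con 2ℚ :- con 2ℚ :* j :+ i :* (con 1ℚ :- j))) refl i j K A ⟩
  K * A * (2ℚ - 2ℚ * j + i * (1ℚ - j)) ≡⟨ cong (λ x → K * A * (2ℚ - 2ℚ * j + x)) (inv-suc m) ⟨
  K * A * (2ℚ - 2ℚ * j + j)
    ≡⟨ solve 3 (λ j K A → K :* A :* (con 2ℚ :- con 2ℚ :* j :+ j) := con 2ℚ :* K :* (A :* (con 1ℚ :- con ½ :* j))) refl j K A ⟩
  2ℚ * K * (A * (1ℚ - ½ * j)) ∎
  where
  open ≤-Reasoning
  i = inv m
  j = inv (suc m)
  A = a (suc m)
  K = 2^ (suc p)

0≤S : ∀ p q N m → 0ℚ ≤ℚ S p q N m
0≤S zero    q N m = 0≤L q N m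
0≤S (suc p) q N m = 0≤+ (0≤S p (suc q) N m) (0≤* (0≤E (suc p) m) (0≤L q N m))

E*L≤ : ∀ p q N m → E p m * L q N m ≤ℚ 2^ (2 ℕ.+ p) * a (suc m)
E*L≤ p q N m = begin
  E p m * L q N m        ≤⟨ *-monoˡ (E p m) (0≤E p m) (L≤ q N m) ⟩
  E p m * (2ℚ * inv m)   ≡⟨ solve 2 (λ e i → e :* (con 2ℚ :* i) := con 2ℚ :* (e :* i)) refl (E p m) (inv m) ⟩
  2ℚ * (E p m * inv m)   ≤⟨ *-monoˡ 2ℚ 0≤2 (E-bound p m) ⟩
  2ℚ * (2^ (suc p) * a (suc m)) ≡⟨ *-assoc 2ℚ (2^ (suc p)) (a (suc m)) ⟨
  2^ (2 ℕ.+ p) * a (suc m) ∎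
  where open ≤-Reasoning

2^-suc : ∀ k → 2^ k ≤ℚ 2^ (suc k)
2^-suc k = ≤-by {2^ k} {2^ (suc k)} (2^ k) (0≤2^ k) (solve 1 (λ K → con 2ℚ :* K := K :+ K) refl (2^ k))

-- By `E*L≤` the summand of index j is at most 2^(j+2) a(m+1), and these powers sum to less than
-- 2^(p+3).
S≤ : ∀ p q N m → S p q N m ≤ℚ 2^ (3 ℕ.+ p) * a (suc m)
S≤ zero q N m = begin
  L q N m                ≡⟨ *-identityˡ (L q N m) ⟨
  1ℚ * L q N m           ≤⟨ E*L≤ zero q N m ⟩
  2^ 2 * a (suc m)       ≤⟨ *-monoʳ {2^ 2} {2^ 3} (a (suc m)) (0≤a (suc m)) (2^-suc 2) ⟩
  2^ 3 * a (suc m)       ∎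
  where open ≤-Reasoning
S≤ (suc p) q N m = begin
  S p (suc q) N m + E (suc p) m * L q N m  ≤⟨ +-mono-≤ (S≤ p (suc q) N m) (E*L≤ (suc p) q N m) ⟩
  2^ (3 ℕ.+ p) * A + 2^ (3 ℕ.+ p) * A
    ≡⟨ solve 2 (λ x A → x :* A :+ x :* A := con 2ℚ :* x :* A) refl (2^ (3 ℕ.+ p)) A ⟩
  2^ (4 ℕ.+ p) * A ∎
  where
  open ≤-Reasoning
  A = a (suc m)

inv-even≤inv : ∀ m → inv (m ℕ.* 2) ≤ℚ inv m
inv-even≤inv m = inv-anti-≤ (ℕ.m≤m*n m 2)

2E*inv≤ : ∀ p m → 2ℚ * (inv (m ℕ.* 2) * E p m) ≤ℚ 2^ (2 ℕ.+ p) * a (suc m)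
2E*inv≤ p m = begin
  2ℚ * (inv (m ℕ.* 2) * E p m) ≤⟨ *-monoˡ 2ℚ 0≤2 (*-monoʳ (E p m) (0≤E p m) (inv-even≤inv m)) ⟩
  2ℚ * (inv m * E p m)         ≡⟨ cong (2ℚ *_) (*-comm (inv m) (E p m)) ⟩
  2ℚ * (E p m * inv m)         ≤⟨ *-monoˡ 2ℚ 0≤2 (E-bound p m) ⟩
  2ℚ * (2^ (suc p) * a (suc m)) ≡⟨ *-assoc 2ℚ (2^ (suc p)) (a (suc m)) ⟨
  2^ (2 ℕ.+ p) * a (suc m) ∎
  where open ≤-Reasoning

0≤g : ∀ n m → 0ℚ ≤ℚ g n m
0≤g n m = 0≤* (0≤* (0≤a n) (0≤c n m)) (0≤* 0≤2 (0≤inv (m ℕ.* 2)))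

0≤remainder : ∀ p n M → 0ℚ ≤ℚ ∑ M (λ m → E p m * g n m)
0≤remainder p n M = ∑-nonneg M λ m → 0≤* (0≤E p m) (0≤g n m)

-- The factor 2/(2m+1) inside `g` keeps `E p m` below the constant `K`. What is left is a(n) times a
-- sum of `c n m`, at most 2 because M ≤ n.
remainder≤ : ∀ p n M → M ≤ n → ∑ M (λ m → E p m * g n m) ≤ℚ 2^ (3 ℕ.+ p) * a n
remainder≤ p n M M≤n = begin
  ∑ M (λ m → E p m * g n m) ≤⟨ ∑-mono M term≤ ⟩
  ∑ M (λ m → K * a n * c n m) ≡⟨ ∑-*ˡ M (K * a n) (c n) ⟩
  K * a n * ∑ M (c n)         ≤⟨ *-monoˡ (K * a n) (0≤* (0≤2^ (2 ℕ.+ p)) (0≤a n)) (∑c≤2 n M M≤n) ⟩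
  K * a n * 2ℚ                ≡⟨ solve 2 (λ K a → K :* a :* con 2ℚ := con 2ℚ :* K :* a) refl K (a n) ⟩
  2ℚ * K * a n                ∎
  where
  open ≤-Reasoning
  K = 2^ (2 ℕ.+ p)
  term≤ : ∀ m → E p m * g n m ≤ℚ K * a n * c n m
  term≤ m = begin
    E p m * (a n * c n m * (2ℚ * inv (m ℕ.* 2)))
      ≡⟨ solve 4 (λ e a c j → e :* (a :* c :* (con 2ℚ :* j)) := a :* c :* (con 2ℚ :* (j :* e))) refl (E p m) (a n) (c n m) (inv (m ℕ.* 2)) ⟩
    a n * c n m * (2ℚ * (inv (m ℕ.* 2) * E p m))
      ≤⟨ *-monoˡ (a n * c n m) (0≤* (0≤a n) (0≤c n m)) (≤-trans (2E*inv≤ p m) (≤-trans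
           (*-monoˡ K (0≤2^ (2 ℕ.+ p)) (a≤1 (suc m))) (≤-reflexive (*-identityʳ K)))) ⟩
    a n * c n m * K ≡⟨ solve 3 (λ a c K → a :* c :* K := K :* a :* c) refl (a n) (c n m) K ⟩
    K * a n * c n m ∎

-- Null sequences.

-- One-sided form of convergence to 0, here applied to nonnegative sequences.
Null : (ℕ → ℚ) → Set
Null f = ∀ ε → Positive ε → ∃[ M ] (∀ n → M ≤ n → f n < ε)

fromℚᵘ-mono-≤ : ∀ {p q} → p ℚᵘ.≤ q → fromℚᵘ p ≤ℚ fromℚᵘ q
fromℚᵘ-mono-≤ {p} {q} p≤q = toℚᵘ-cancel-≤ (ℚᵘ.≤-respˡ-≃ (ℚᵘ.≃-sym (toℚᵘ-fromℚᵘ p))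
  (ℚᵘ.≤-respʳ-≃ (ℚᵘ.≃-sym (toℚᵘ-fromℚᵘ q)) p≤q))

invᵘ≤ : ∀ n d → invᵘ d ℚᵘ.≤ ℚᵘ.mkℚᵘ (+ suc n) d
invᵘ≤ n d = ℚᵘ.*≤* (ℤ.*-monoʳ-≤-nonNeg (+ suc d) {+ 1} {+ suc n} (ℤ.+≤+ (ℕ.s≤s ℕ.z≤n)))

-- A positive numerator is at least 1, so the denominator of `ε` supplies the witness.
inv-below : ∀ ε → Positive ε → ∃[ d ] inv d ≤ℚ ε
inv-below ε@(mkℚ (+ suc n) d _) _ = d , subst (inv d ≤ℚ_) (fromℚᵘ-toℚᵘ ε) (fromℚᵘ-mono-≤ {invᵘ d} {ℚᵘ.mkℚᵘ (+ suc n) d} (invᵘ≤ n d))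

inv² : ∀ d → inv d * inv d ≡ inv (d ℕ.+ d ℕ.* suc d)
inv² d = sym (inv-unique (d ℕ.+ d ℕ.* suc d) (i * i) (begin
  i * i * ι (suc d ℕ.* suc d)     ≡⟨ cong (i * i *_) (ι-* (suc d) (suc d)) ⟩
  i * i * (ι (suc d) * ι (suc d)) ≡⟨ solve 2 (λ i n → i :* i :* (n :* n) := (i :* n) :* (i :* n)) refl i (ι (suc d)) ⟩
  i * ι (suc d) * (i * ι (suc d)) ≡⟨ cong₂ _*_ (inv-inverse d) (inv-inverse d) ⟩
  1ℚ ∎))
  where
  open ≡-Reasoning
  i = inv d

a-null : Null a
a-null ε ε>0 with inv-below ε ε>0
-- If a(n) were at least 1/(d+1), then 1/(d+1)² ≤ a(n)² ≤ 1/(n+1), impossible for n ≥ (d+1)². The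
-- threshold unfolds to the strict inequality that `inv-anti-<` needs.
... | d , invd≤ε = suc d ℕ.* suc d , λ n M≤n → <-≤-trans (≰⇒> λ invd≤a →
        <-irrefl {inv n} refl (<-≤-trans (inv-anti-< M≤n) (begin
          inv (d ℕ.+ d ℕ.* suc d) ≡⟨ inv² d ⟨
          inv d * inv d           ≤⟨ *-mono (0≤inv d) (0≤a n) invd≤a invd≤a ⟩
          a n * a n               ≤⟨ a²≤inv n ⟩
          inv n                   ∎))) invd≤ε
  where open ≤-Reasoning

Null-2* : ∀ {f} → Null f → Null (λ n → 2ℚ * f n)
Null-2* {f} f-null ε ε>0 = map₂ (λ f<½ε n M≤n → <-respʳ-≡ {2ℚ * f n} {2ℚ * (½ * ε)} {ε}
    (solve 1 (λ ε → con 2ℚ :* (con ½ :* ε) := ε) refl ε)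
    (*-monoʳ-<-pos 2ℚ {f n} {½ * ε} (f<½ε n M≤n)))
  (f-null (½ * ε) (pos*pos⇒pos ½ ε {{ε>0}}))

2^*a-null : ∀ k → Null (λ n → 2^ k * a n)
2^*a-null zero ε ε>0 = map₂
  (λ a<ε n M≤n → <-respˡ-≡ {ε} {a n} {1ℚ * a n} (sym (*-identityˡ (a n))) (a<ε n M≤n))
  (a-null ε ε>0)
2^*a-null (suc k) ε ε>0 = map₂
  (λ a<ε n M≤n → <-respˡ-≡ {ε} {2ℚ * (2^ k * a n)} {2^ (suc k) * a n}
    (sym (*-assoc 2ℚ (2^ k) (a n))) (a<ε n M≤n))
  (Null-2* {λ n → 2^ k * a n} (2^*a-null k) ε ε>0)

-- Convergence of the left-hand series.

∣∣≤ : ∀ {x y} → x ≤ℚ y → - x ≤ℚ y → ∣ x ∣ ≤ℚ y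
∣∣≤ {x} {y} x≤y -x≤y = [ (λ eq → subst (_≤ℚ y) (sym eq) x≤y) , (λ eq → subst (_≤ℚ y) (sym eq) -x≤y) ]′ (∣p∣≡p∨∣p∣≡-p x)

∣-∣≤ : ∀ {x y z} → 0ℚ ≤ℚ x → 0ℚ ≤ℚ y → x ≤ℚ z → y ≤ℚ z → ∣ x - y ∣ ≤ℚ z
∣-∣≤ {x} {y} 0≤x 0≤y x≤z y≤z = ∣∣≤
  (≤-trans (≤-by y 0≤y (solve 2 (λ x y → x := x :- y :+ y) refl x y)) x≤z)
  (≤-trans (≤-by x 0≤x (solve 2 (λ x y → y := :- (x :- y) :+ x) refl x y)) y≤z)

lhs-increasing : ∀ p {m n} → m ℕ.≤′ n → lhsPartial p m ≤ℚ lhsPartial p n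
lhs-increasing p (ℕ.≤′-reflexive refl)   = ≤-refl
lhs-increasing p {m} {suc n} (ℕ.≤′-step m≤n) = ≤-trans (lhs-increasing p m≤n)
  (≤-by (a (suc n) * powQ (inv n) (suc p)) (0≤lhsTerm p n) (lhsPartial-suc p n))

-- With `lhs-increasing` this confines all partial sums from `m` on to an interval of length 2 a(m).
lhs+2a-decreasing : ∀ p {m n} → m ℕ.≤′ n → lhsPartial p n + 2ℚ * a n ≤ℚ lhsPartial p m + 2ℚ * a m
lhs+2a-decreasing p (ℕ.≤′-reflexive refl)   = ≤-refl
lhs+2a-decreasing p {m} {suc n} (ℕ.≤′-step m≤n) = begin
  lhsPartial p (suc n) + 2ℚ * a (suc n)                    ≡⟨ cong (_+ 2ℚ * a (suc n)) (lhsPartial-suc p n) ⟩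
  lhsPartial p n + t + 2ℚ * a (suc n)                      ≤⟨ +-monoˡ-≤ (2ℚ * a (suc n)) (+-monoʳ-≤ (lhsPartial p n) (lhsTerm≤ p n)) ⟩
  lhsPartial p n + 2ℚ * (a n - a (suc n)) + 2ℚ * a (suc n)
    ≡⟨ solve 3 (λ x a b → x :+ con 2ℚ :* (a :- b) :+ con 2ℚ :* b := x :+ con 2ℚ :* a) refl (lhsPartial p n) (a n) (a (suc n)) ⟩
  lhsPartial p n + 2ℚ * a n                                ≤⟨ lhs+2a-decreasing p m≤n ⟩
  lhsPartial p m + 2ℚ * a m                                ∎
  where
  open ≤-Reasoning
  t = a (suc n) * powQ (inv n) (suc p)

lhs-tail : ∀ p {M m n} → M ≤ m → m ≤ n → ∣ lhsPartial p m - lhsPartial p n ∣ ≤ℚ 2ℚ * a M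
lhs-tail p {M} {m} {n} M≤m m≤n = ∣∣≤ {x - y} {2ℚ * a M}
  (≤-trans (≤-by {x - y} {0ℚ} (y - x) (≤⇒0≤- (lhs-increasing p (ℕ.≤⇒≤′ m≤n)))
      (solve 2 (λ x y → con 0ℚ := x :- y :+ (y :- x)) refl x y))
    (0≤* 0≤2 (0≤a M)))
  (≤-trans (≤-by { - (x - y)} {2ℚ * a m} (x + 2ℚ * a m - (y + 2ℚ * a n) + 2ℚ * a n)
      (0≤+ (≤⇒0≤- (lhs+2a-decreasing p (ℕ.≤⇒≤′ m≤n))) (0≤* 0≤2 (0≤a n)))
      (solve 4 (λ x y a b → con 2ℚ :* a := :- (x :- y) :+ ((x :+ con 2ℚ :* a) :- (y :+ con 2ℚ :* b) :+ con 2ℚ :* b)) refl x y (a m) (a n)))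
    (*-monoˡ 2ℚ 0≤2 (a-anti M≤m)))
  where
  x = lhsPartial p m
  y = lhsPartial p n

∣-∣-swap : ∀ x y → ∣ x - y ∣ ≡ ∣ y - x ∣
∣-∣-swap x y = trans (sym (∣-p∣≡∣p∣ (x - y)))
  (cong ∣_∣ (solve 2 (λ x y → :- (x :- y) := y :- x) refl x y))

lhs-tail′ : ∀ p {M m n} → M ≤ m → M ≤ n → ∣ lhsPartial p m - lhsPartial p n ∣ ≤ℚ 2ℚ * a M
lhs-tail′ p {M} {m} {n} M≤m M≤n = [ lhs-tail p M≤m
  , (λ n≤m → subst (_≤ℚ 2ℚ * a M) (∣-∣-swap (lhsPartial p n) (lhsPartial p m)) (lhs-tail p M≤n n≤m)) ]′ (ℕ.≤-total m n)

lhs-cauchy : ∀ p ε → Positive ε → ∃[ M ] (∀ m n → M ≤ m → M ≤ n → ∣ lhsPartial p m - lhsPartial p n ∣ < ε)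
lhs-cauchy p ε ε>0 = map₂
  (λ {M} a<ε m n M≤m M≤n → ≤-<-trans (lhs-tail′ p M≤m M≤n) (a<ε M ℕ.≤-refl))
  (Null-2* {a} a-null ε ε>0)

-- The difference of the two sides tends to 0.

difference-even : ∀ p N M → M ≤ N → ∣ lhsPartial p N + 2ℚ * zetaBar1Hat1Partial p (M ℕ.* 2) ∣ ≤ℚ 2^ (3 ℕ.+ p) * a (suc M)
difference-even p N M M≤N = begin
  ∣ x ∣     ≡⟨ cong ∣_∣ (trans (solve 2 (λ x r → x := x :+ r :- r) refl x r) (cong (_- r) (lhs+2zeta≡S p N M))) ⟩
  ∣ S p 0 N M - r ∣
    -- Both terms are nonnegative, so a common upper bound also bounds their difference.
    ≤⟨ ∣-∣≤ (0≤S p 0 N M) (0≤remainder p (suc N) M) (S≤ p 0 N M)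
         (≤-trans (remainder≤ p (suc N) M (ℕ.m≤n⇒m≤1+n M≤N))
           (*-monoˡ (2^ (3 ℕ.+ p)) (0≤2^ (3 ℕ.+ p)) (a-anti (ℕ.s≤s M≤N)))) ⟩
  2^ (3 ℕ.+ p) * a (suc M) ∎
  where
  open ≤-Reasoning
  x = lhsPartial p N + 2ℚ * zetaBar1Hat1Partial p (M ℕ.* 2)
  r = ∑ M (λ m → E p m * g (suc N) m)

difference-odd : ∀ p N M → M ≤ N → ∣ lhsPartial p N + 2ℚ * zetaBar1Hat1Partial p (suc (M ℕ.* 2)) ∣ ≤ℚ 2^ (4 ℕ.+ p) * a (suc M)
difference-odd p N M M≤N = begin
  ∣ x + 2ℚ * zetaBar1Hat1Partial p (suc (M ℕ.* 2)) ∣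
    ≡⟨ cong (λ w → ∣ x + 2ℚ * w ∣) (zeta-odd p M) ⟩
  ∣ x + 2ℚ * (z - v) ∣ ≡⟨ cong ∣_∣ (solve 3 (λ x z v → x :+ con 2ℚ :* (z :- v) := (x :+ con 2ℚ :* z) :- con 2ℚ :* v) refl x z v) ⟩
  ∣ (x + 2ℚ * z) - 2ℚ * v ∣ ≤⟨ ∣p-q∣≤∣p∣+∣q∣ (x + 2ℚ * z) (2ℚ * v) ⟩
  ∣ x + 2ℚ * z ∣ + ∣ 2ℚ * v ∣ ≡⟨ cong (λ w → ∣ x + 2ℚ * z ∣ + w) (0≤p⇒∣p∣≡p (0≤* 0≤2 (0≤* (0≤inv (M ℕ.* 2)) (0≤E p M)))) ⟩
  ∣ x + 2ℚ * z ∣ + 2ℚ * v ≤⟨ +-mono-≤ (difference-even p N M M≤N) (2E*inv≤ p M) ⟩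
  2ℚ * K * A + K * A
    ≤⟨ ≤-by (K * A) (0≤* (0≤2^ (2 ℕ.+ p)) (0≤a (suc M)))
       (solve 2 (λ K A → con 2ℚ :* (con 2ℚ :* K) :* A := con 2ℚ :* K :* A :+ K :* A :+ K :* A) refl K A) ⟩
  2^ (4 ℕ.+ p) * A ∎
  where
  open ≤-Reasoning
  x = lhsPartial p N
  z = zetaBar1Hat1Partial p (M ℕ.* 2)
  v = inv (M ℕ.* 2) * E p M
  K = 2^ (2 ℕ.+ p)
  A = a (suc M)

parity : ∀ N → ∃[ M ] (N ≡ M ℕ.* 2 ⊎ N ≡ suc (M ℕ.* 2))
parity zero = 0 , inj₁ refl
parity (suc N) with parity N
... | M , inj₁ refl = M , inj₂ refl
... | M , inj₂ refl = suc M , inj₁ refl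

-- `M` is half of `N`, rounded down; N ≤ 2M+1 is recorded so that `M` is known to grow with `N`. The
-- exponent 4+p serves both parities.
difference-bound : ∀ p N → ∃[ M ] (N ≤ suc (M ℕ.* 2) ×
  ∣ lhsPartial p N + 2ℚ * zetaBar1Hat1Partial p N ∣ ≤ℚ 2^ (4 ℕ.+ p) * a (suc M))
difference-bound p N = map₂ (λ {M} →
    [ (λ eq → subst (Bound M) (sym eq) (ℕ.n≤1+n (M ℕ.* 2) ,
        ≤-trans (difference-even p (M ℕ.* 2) M (ℕ.m≤m*n M 2))
          (*-monoʳ {2^ (3 ℕ.+ p)} {2^ (4 ℕ.+ p)} (a (suc M)) (0≤a (suc M)) (2^-suc (3 ℕ.+ p)))))
    , (λ eq → subst (Bound M) (sym eq) (ℕ.≤-refl ,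
        difference-odd p (suc (M ℕ.* 2)) M (ℕ.m≤n⇒m≤1+n (ℕ.m≤m*n M 2)))) ]′)
  (parity N)
  where
  Bound : ℕ → ℕ → Set
  Bound M N = N ≤ suc (M ℕ.* 2) × ∣ lhsPartial p N + 2ℚ * zetaBar1Hat1Partial p N ∣ ≤ℚ 2^ (4 ℕ.+ p) * a (suc M)

difference-limit : ∀ p ε → Positive ε → ∃[ M ] (∀ N → M ≤ N → ∣ lhsPartial p N + 2ℚ * zetaBar1Hat1Partial p N ∣ < ε)
difference-limit p ε ε>0 = M₀ ℕ.* 2 , λ N M₀*2≤N →
  let M , N≤2M+1 , bound = difference-bound p N
  -- From 2M₀ ≤ N ≤ 2M+1 ≤ 2(M+1), cancelling 2 gives M₀ ≤ M+1, the index at which `a` is evaluated.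
  in ≤-<-trans bound (proj₂ null (suc M) (ℕ.*-cancelʳ-≤ M₀ (suc M) 2 (ℕ.m≤n⇒m≤1+n (ℕ.≤-trans M₀*2≤N N≤2M+1))))
  where
  null = 2^*a-null (4 ℕ.+ p) ε ε>0
  M₀ = proj₁ null

-- The limits need not be rational, so equality is expressed by Cauchy partial sums on the left and
-- a combination tending to 0. Together these make the zeta partial sums Cauchy as well.
theorem2p2 : (p : ℕ) →
    ((ε : ℚ) → Positive ε → ∃[ M ] ((m n : ℕ) → M ≤ m → M ≤ n →
        ∣ lhsPartial p m - lhsPartial p n ∣ < ε))
    × ((ε : ℚ) → Positive ε → ∃[ M ] ((N : ℕ) → M ≤ N →
        ∣ lhsPartial p N + (+ 2 / 1) * zetaBar1Hat1Partial p N ∣ < ε))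
theorem2p2 p = lhs-cauchy p , difference-limit p
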